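{- The problem Coloured Clustering, restricted to edge-bicoloured complete graphs on $n$ vertices, can be solved in $O(n^2)$ time.
   Context: An edge-bicoloured complete graph is a finite complete graph in which each edge $e$ has exactly one colour $\psi(e)\in\{1,2\}$ (not required to be a proper edge colouring). A vertex colouring $f$ assigns to each vertex $v$ a colour $f(v)$ from the set of colours (not required to be proper); an edge $uv$ is stable under $f$ if $\psi(uv)=f(u)=f(v)$. Coloured Clustering: the input is an edge-coloured graph $G$ and a positive integer $k$; the question is whether there is a vertex colouring of $G$ that produces at least $k$ stable edges. -}

module Defs where

open import Data.Fin as Fin using (Fin; toℕ; fromℕ<; remQuot)
import Data.Fin.Properties as Fin
open import Data.List using (List; allFin; cartesianProduct; filter; length)
open import Data.Maybe using (Maybe; just; nothing; maybe′; Is-just)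
import Data.Maybe.Properties as Maybe
open import Data.Nat
open import Data.Product using (∃-syntax; _×_; _,_)
open import Data.Sum using (_⊎_)
open import Relation.Binary.PropositionalEquality using (_≡_; _≢_)
open import Relation.Nullary using (¬_; Dec; yes; no; does)
open import Relation.Nullary.Decidable using (_×-dec_)
open import Data.Bool using (if_then_else_)

-- Finite simple graphs on n vertices whose edges carry colours from q colours.
-- `ψ u v` is `nothing` when uv is not an edge; the colouring need not be proper.
record EdgeColouredGraph (q n : ℕ) : Set where
  field
    ψ      : Fin n → Fin n → Maybe (Fin q)
    sym    : ∀ u v → ψ u v ≡ ψ v u
    noLoop : ∀ v → ψ v v ≡ nothing

open EdgeColouredGraph public

Complete : ∀ {q n} → EdgeColouredGraph q n → Set
Complete G = ∀ u v → u ≢ v → Is-just (ψ G u v)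

VertexColouring : ℕ → ℕ → Set
VertexColouring q n = Fin n → Fin q

Stable : ∀ {q n} → EdgeColouredGraph q n → VertexColouring q n → Fin n × Fin n → Set
Stable G f (u , v) = ψ G u v ≡ just (f u) × f u ≡ f v

stable? : ∀ {q n} (G : EdgeColouredGraph q n) (f : VertexColouring q n) e → Dec (Stable G f e)
stable? G f (u , v) = Maybe.≡-dec Fin._≟_ (ψ G u v) (just (f u)) ×-dec (f u Fin.≟ f v)

-- Each unordered pair of distinct vertices, listed once as (u , v) with u < v.
vertexPairs : ∀ n → List (Fin n × Fin n)
vertexPairs n = filter (λ (u , v) → u Fin.<? v) (cartesianProduct (allFin n) (allFin n))

#stable : ∀ {q n} → EdgeColouredGraph q n → VertexColouring q n → ℕ
#stable {n = n} G f = length (filter (stable? G f) (vertexPairs n))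

ColouredClustering : ∀ {q n} → EdgeColouredGraph q n → ℕ → Set
ColouredClustering {q} {n} G k = ∃[ f ] k ≤ #stable {q} {n} G f

-- The model of computation is a random access machine with uniform (unit) cost.
-- Its only arithmetic is addition and truncated subtraction.  A program is a
-- fixed finite text, so it mentions finitely many registers; unbounded storage
-- is reached only through the indirect instructions `load` and `store`.

Reg : Set
Reg = ℕ

record State : Set where
  constructor ⟪_,_⟫
  field
    reg : Reg → ℕ
    mem : ℕ → ℕ

open State public

infixl 9 _[_↦_]
_[_↦_] : (ℕ → ℕ) → ℕ → ℕ → ℕ → ℕ
(m [ a ↦ x ]) b = if does (b ≟ a) then x else m b

data Instr : Set where
  const : Reg → ℕ → Instr
  move  : Reg → Reg → Instr
  add   : Reg → Reg → Reg → Instr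
  sub   : Reg → Reg → Reg → Instr
  load  : Reg → Reg → Instr
  store : Reg → Reg → Instr

-- The target is the first operand; for `store` it is the memory cell whose
-- address is held in the first operand.
⟦_⟧ : Instr → State → State
⟦ const r c ⟧   ⟪ ρ , m ⟫ = ⟪ ρ [ r ↦ c ] , m ⟫
⟦ move r x ⟧    ⟪ ρ , m ⟫ = ⟪ ρ [ r ↦ ρ x ] , m ⟫
⟦ add r x y ⟧   ⟪ ρ , m ⟫ = ⟪ ρ [ r ↦ ρ x + ρ y ] , m ⟫
⟦ sub r x y ⟧   ⟪ ρ , m ⟫ = ⟪ ρ [ r ↦ ρ x ∸ ρ y ] , m ⟫
⟦ load r x ⟧    ⟪ ρ , m ⟫ = ⟪ ρ [ r ↦ m (ρ x) ] , m ⟫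
⟦ store x y ⟧   ⟪ ρ , m ⟫ = ⟪ ρ , m [ ρ x ↦ ρ y ] ⟫

infixr 5 _⨾_
data Program : Set where
  `_            : Instr → Program
  _⨾_           : Program → Program → Program
  if_≠0then_else_ : Reg → Program → Program → Program
  while_≠0do_   : Reg → Program → Program

-- ⟨ p , s ⟩⇓[ t ] s′ : started in s, the program p halts in s′ after exactly t
-- steps, where every instruction and every evaluation of a test is one step.
data ⟨_,_⟩⇓[_]_ : Program → State → ℕ → State → Set where
  instr  : ∀ {i s} →
           ⟨ ` i , s ⟩⇓[ 1 ] ⟦ i ⟧ s
  seq    : ∀ {p q s s′ s″ t t′} →
           ⟨ p , s ⟩⇓[ t ] s′ → ⟨ q , s′ ⟩⇓[ t′ ] s″ →
           ⟨ p ⨾ q , s ⟩⇓[ t + t′ ] s″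
  ifThen : ∀ {r p q s s′ t} → reg s r ≢ 0 →
           ⟨ p , s ⟩⇓[ t ] s′ →
           ⟨ if r ≠0then p else q , s ⟩⇓[ suc t ] s′
  ifElse : ∀ {r p q s s′ t} → reg s r ≡ 0 →
           ⟨ q , s ⟩⇓[ t ] s′ →
           ⟨ if r ≠0then p else q , s ⟩⇓[ suc t ] s′
  exit   : ∀ {r p s} → reg s r ≡ 0 →
           ⟨ while r ≠0do p , s ⟩⇓[ 1 ] s
  loop   : ∀ {r p s s′ s″ t t′} → reg s r ≢ 0 →
           ⟨ p , s ⟩⇓[ t ] s′ → ⟨ while r ≠0do p , s′ ⟩⇓[ t′ ] s″ →
           ⟨ while r ≠0do p , s ⟩⇓[ suc (t + t′) ] s″

-- Colours are numbered from 1 in memory; 0 marks a non-edge.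
code : ∀ {q} → Maybe (Fin q) → ℕ
code = maybe′ (λ c → suc (toℕ c)) 0

-- The adjacency matrix in row-major order: cell n * u + v holds the colour of uv.
matrix : ∀ {q n} → EdgeColouredGraph q n → ℕ → ℕ
matrix {n = n} G a with a <? n * n
... | yes a<n² = let (u , v) = remQuot n (fromℕ< a<n²) in code (ψ G u v)
... | no  _    = 0

-- Register 0 holds n, register 1 holds k, and all other registers hold 0.
input : ∀ {q n} → EdgeColouredGraph q n → ℕ → State
input {n = n} G k = ⟪ (λ _ → 0) [ 0 ↦ n ] [ 1 ↦ k ] , matrix G ⟫

-- The answer is delivered in register 0: 1 for yes, 0 for no.
Answers : State → Set → Set
Answers s P = (P × reg s 0 ≡ 1) ⊎ (¬ P × reg s 0 ≡ 0)

_decides_on_within_ : Program → Set → State → ℕ → Set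
p decides P on s within b =
  ∃[ t ] ∃[ s′ ] ⟨ p , s ⟩⇓[ t ] s′ × t ≤ b × Answers s′ P

_∈O_ : (ℕ → ℕ) → (ℕ → ℕ) → Set
T ∈O g = ∃[ c ] ∃[ n₀ ] ∀ n → n₀ ≤ n → T n ≤ c * g n

module Submission where

-- Let d(v) be the number of edges of colour 2 at v, and let s = |S| where S is the
-- set of vertices given colour 1.  Counting ordered pairs of vertices, twice the
-- number of stable edges is
--   Σ_{v ∉ S} d(v) − Σ_{v ∈ S} (d(v) + 1) + s².
-- Since s² = max_m (2ms − m²), attained at m = s, the maximum over S of this number is
--   max_m (Σ_v max(d(v), 2m − d(v) − 1) − m²),
-- because for fixed m the best S is {v : d(v) < m}.  After the n degrees have been
-- computed, each of the n + 1 values of m takes linear time.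

open import Defs
open import Data.Bool using (Bool; true; false; if_then_else_)
open import Data.Fin as Fin using (Fin; toℕ; zero; suc; fromℕ<; remQuot; combine)
import Data.Fin.Properties as Fin
import Data.List as List
import Data.List.Properties as List
open import Data.List using ([]; _∷_; _++_; filter; length; allFin; cartesianProduct; tabulate)
open import Data.Maybe using (Maybe; just; nothing; Is-just)
import Data.Maybe.Properties as Maybe
open import Data.Nat
open import Data.Nat.ListAction using () renaming (sum to listSum)
open import Data.Nat.ListAction.Properties using (sum-++)
open import Data.Nat.Properties
open import Data.Nat.Tactic.RingSolver using (solve-∀)
open import Algebra.Properties.Semiring.Sum +-*-semiring
  using (sum; sum-cong-≗; ∑-distrib-+; ∑-comm; *-distribˡ-sum; *-distribʳ-sum; sum-replicate-zero)
open import Data.Product using (_×_; _,_; ∃-syntax)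
open import Data.Sum using (_⊎_; inj₁; inj₂)
open import Function using (_∘_; mk⇔)
open import Relation.Binary using (tri<; tri≈; tri>)
open import Relation.Binary.PropositionalEquality as ≡
  using (_≡_; _≢_; refl; cong; cong₂; subst; subst₂; ≢-sym; module ≡-Reasoning)
open import Relation.Nullary using (Dec; yes; no; does; contradiction; ¬_)
open import Relation.Nullary.Decidable using (dec-true; dec-false; does-⇔; _×-dec_)
open import Relation.Unary using (Decidable)

-- Executing the program

update-here : ∀ m a x → (m [ a ↦ x ]) a ≡ x
update-here m a x rewrite dec-true (a ≟ a) refl = refl

update-elsewhere : ∀ m {a b} x → b ≢ a → (m [ a ↦ x ]) b ≡ m b
update-elsewhere m {a} {b} x b≢a rewrite dec-false (b ≟ a) b≢a = refl

retime : ∀ {p s s′ t t′} → t ≡ t′ → ⟨ p , s ⟩⇓[ t ] s′ → ⟨ p , s ⟩⇓[ t′ ] s′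
retime refl run = run

-- The index of the invariant is the number of iterations still to be done.
while-rule : ∀ {r body c} (I : ℕ → State → Set) →
  (∀ {j s} → I j s → reg s r ≡ j) →
  (∀ {j s} → I (suc j) s → ∃[ s′ ] ⟨ body , s ⟩⇓[ c ] s′ × I j s′) →
  ∀ j {s} → I j s →
  ∃[ s′ ] ⟨ while r ≠0do body , s ⟩⇓[ suc (j * suc c) ] s′ × I 0 s′
while-rule I counter step zero i = _ , exit (counter i) , i
while-rule {c = c} I counter step (suc j) i with step i
... | s₁ , run₁ , i₁ with while-rule I counter step j i₁
... | s₂ , run₂ , i₂ =
  s₂ , retime (cong suc (+-suc c (j * suc c)))
         (loop (λ r≡0 → 1+n≢0 (≡.trans (≡.sym (counter i)) r≡0)) run₁ run₂) , i₂

-- Registers and a generic scan over n consecutive cells.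

size bound one todo row threshold count inner pointer acc val aux : Reg
size      = 0
bound     = 1
one       = 2
todo      = 3
row       = 4
threshold = 5
count     = 6
inner     = 7
pointer   = 8
acc       = 9
val       = 10
aux       = 11

-- What a scan must leave unchanged, bundled so that one equation preserves all of it. `inner`,
-- `pointer`, `acc`, `val` and `aux` are absent because a scan works with them.
record Frame : Set where
  field
    memory : ℕ → ℕ
    #size #bound #one #todo #row #threshold #count : ℕ

open Frame

frame : State → Frame
frame s = record
  { memory     = mem s
  ; #size      = reg s size
  ; #bound     = reg s bound
  ; #one       = reg s one
  ; #todo      = reg s todo
  ; #row       = reg s row
  ; #threshold = reg s threshold
  ; #count     = reg s count
  }

scanStep : Program → Program
scanStep body =
  ` load val pointer ⨾ body ⨾ ` add acc acc val ⨾
  ` add pointer pointer one ⨾ ` sub inner inner one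

-- `pointer` is not reset here: each scan of the degree phase resumes where the previous one
-- stopped, so row addresses need no multiplication.
scan : Program → Program
scan body = ` const acc 0 ⨾ ` move inner size ⨾ while inner ≠0do scanStep body

-- `aux` is neither in the frame nor constrained here, so a body may use it as scratch space.
Evaluates : Program → ℕ → (Frame → ℕ → ℕ) → Set
Evaluates body c g = ∀ s → ∃[ s′ ] ⟨ body , s ⟩⇓[ c ] s′
  × frame s′ ≡ frame s × reg s′ inner ≡ reg s inner × reg s′ pointer ≡ reg s pointer
  × reg s′ acc ≡ reg s acc × reg s′ val ≡ g (frame s) (reg s val)

scanTime : ℕ → ℕ → ℕ
scanTime c n = 3 + n * (5 + c)

module _ {body : Program} {c : ℕ} {g : Frame → ℕ → ℕ} (ev : Evaluates body c g) (s₀ : State) where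

  private
    term : ℕ → ℕ
    term a = g (frame s₀) (mem s₀ a)

  -- `so-far` adds to `acc` the sum still to come, indexed from the current `pointer`. A step only
  -- peels off the first term of that sum, and on exit the sum is empty.
  record Scanning (j : ℕ) (s : State) : Set where
    field
      kept   : frame s ≡ frame s₀
      left   : reg s inner ≡ j
      at     : reg s pointer + j ≡ reg s₀ pointer + reg s₀ size
      so-far : reg s acc + sum {j} (λ i → term (reg s pointer + toℕ i))
             ≡ sum {reg s₀ size} (λ i → term (reg s₀ pointer + toℕ i))

  open Scanning

  scanning-step : reg s₀ one ≡ 1 → ∀ {j s} → Scanning (suc j) s →
    ∃[ s′ ] ⟨ scanStep body , s ⟩⇓[ 4 + c ] s′ × Scanning j s′
  scanning-step one≡1 {j} {s} I with ev (⟦ load val pointer ⟧ s)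
  ... | s₁ , run , frame≡ , inner≡ , pointer≡ , acc≡ , val≡ =
    _ , retime (cong suc (+-comm c 3))
          (seq instr (seq run (seq instr (seq instr instr))))
      , record { kept = kept₁ ; left = left₁ ; at = at₁ ; so-far = so-far₁ }
    where
    kept₁ : frame s₁ ≡ frame s₀
    kept₁ = ≡.trans frame≡ (kept I)
    one₁ : reg s₁ one ≡ 1
    one₁ = ≡.trans (cong #one kept₁) one≡1
    left₁ : reg s₁ inner ∸ reg s₁ one ≡ j
    left₁ = cong₂ _∸_ (≡.trans inner≡ (left I)) one₁
    next : reg s₁ pointer + reg s₁ one ≡ suc (reg s pointer)
    next = ≡.trans (cong₂ _+_ pointer≡ one₁) (+-comm _ 1)
    at₁ : reg s₁ pointer + reg s₁ one + j ≡ reg s₀ pointer + reg s₀ size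
    at₁ = ≡.trans (cong (_+ j) next) (≡.trans (≡.sym (+-suc _ j)) (at I))
    val₁ : reg s₁ val ≡ term (reg s pointer + 0)
    val₁ = ≡.trans val≡ (cong₂ g (kept I)
      (≡.trans (cong (λ κ → memory κ (reg s pointer)) (kept I))
               (cong (mem s₀) (≡.sym (+-identityʳ _)))))
    tail≡ : sum {j} (λ i → term (reg s₁ pointer + reg s₁ one + toℕ i))
          ≡ sum {j} (λ i → term (reg s pointer + suc (toℕ i)))
    tail≡ = sum-cong-≗ {j} λ i →
      cong term (≡.trans (cong (_+ toℕ i) next) (≡.sym (+-suc (reg s pointer) (toℕ i))))
    so-far₁ : reg s₁ acc + reg s₁ val
                + sum {j} (λ i → term (reg s₁ pointer + reg s₁ one + toℕ i))
            ≡ sum {reg s₀ size} (λ i → term (reg s₀ pointer + toℕ i))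
    so-far₁ = ≡.trans (cong₂ _+_ (cong₂ _+_ acc≡ val₁) tail≡)
      (≡.trans (+-assoc (reg s acc) _ _) (so-far I))

  scan-runs : reg s₀ one ≡ 1 →
    ∃[ s ] ⟨ scan body , s₀ ⟩⇓[ scanTime c (reg s₀ size) ] s
      × frame s ≡ frame s₀
      × reg s pointer ≡ reg s₀ pointer + reg s₀ size
      × reg s acc ≡ sum {reg s₀ size} (λ i → term (reg s₀ pointer + toℕ i))
  scan-runs one≡1
    with while-rule Scanning left (scanning-step one≡1) (reg s₀ size)
           {⟦ move inner size ⟧ (⟦ const acc 0 ⟧ s₀)}
           (record { kept = refl ; left = refl ; at = refl ; so-far = refl })
  ... | s , run , I =
    s , seq instr (seq instr run) , kept I
      , ≡.trans (≡.sym (+-identityʳ _)) (at I)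
      , ≡.trans (≡.sym (+-identityʳ _)) (so-far I)

-- Colour codes 0, 1, 2 become 0, 0, 1.
degreeBody : Program
degreeBody = ` sub val val one

degreeTerm : Frame → ℕ → ℕ
degreeTerm κ x = x ∸ #one κ

degreeBody-evaluates : Evaluates degreeBody 1 degreeTerm
degreeBody-evaluates s = _ , instr , refl , refl , refl , refl , refl

-- Truncated subtraction replaces a comparison: `aux` starts as m ∸ d, so the two additions
-- contribute nothing when m ≤ d and raise d to 2m - d - 1 when d < m.
thresholdBody : Program
thresholdBody =
  ` sub aux threshold val ⨾ ` add val val aux ⨾ ` sub aux aux one ⨾ ` add val val aux

thresholdTerm : Frame → ℕ → ℕ
thresholdTerm κ d = d + (#threshold κ ∸ d) + (#threshold κ ∸ d ∸ #one κ)

thresholdBody-evaluates : Evaluates thresholdBody 4 thresholdTerm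
thresholdBody-evaluates s =
  _ , seq instr (seq instr (seq instr instr)) , refl , refl , refl , refl , refl

-- max d (2m − d − 1)
gain : ℕ → ℕ → ℕ
gain m d = d + (m ∸ d) + (m ∸ d ∸ 1)

-- The program and its exact step counts.

degreesStep degrees thresholdsStep thresholds clustering : Program
degreesStep = scan degreeBody ⨾ ` store row acc ⨾ ` add row row one ⨾ ` sub todo todo one
degrees     = ` move todo size ⨾ while todo ≠0do degreesStep
-- The bound 2k + m² is updated by (m + 1)² = m² + m + (m + 1).
thresholdsStep =
  ` const pointer 0 ⨾ scan thresholdBody ⨾
  -- By truncation `val` becomes 1 when 2k + m² is at most the scanned sum, and 0 otherwise; `count`
  -- collects the successes.
  ` sub val bound acc ⨾ ` sub val one val ⨾ ` add count count val ⨾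
  ` add bound bound threshold ⨾ ` add threshold threshold one ⨾
  ` add bound bound threshold ⨾ ` sub todo todo one
thresholds  =
  ` add bound bound bound ⨾ ` add todo size one ⨾ while todo ≠0do thresholdsStep
clustering  =
  -- The last two subtractions turn any positive `count` into 1.
  ` const one 1 ⨾ degrees ⨾ thresholds ⨾ ` sub val one count ⨾ ` sub 0 one val

-- In the two loop times the leading summand covers the set-up instructions and the final failing
-- test; the parenthesised factor is one iteration including its test.
degreesTime thresholdsTime clusteringTime : ℕ → ℕ
degreesTime n    = 2 + n * (4 + scanTime 1 n)
thresholdsTime n = 3 + suc n * (9 + scanTime 4 n)
clusteringTime n = 1 + (degreesTime n + (thresholdsTime n + 2))

-- Loop invariants and the final content of register 0.

module _ (M : ℕ → ℕ) (n : ℕ) where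

  degreeAt : ℕ → ℕ
  degreeAt u = sum {n} (λ v → M (n * u + toℕ v) ∸ 1)

  total : ℕ → ℕ
  total m = sum {n} (λ v → gain m (degreeAt (toℕ v)))

module _ (M : ℕ → ℕ) (n k : ℕ) where

  -- The indicator of 2k + m² ≤ `total M n m`, kept in the form in which the machine computes it.
  verdict : ℕ → ℕ
  verdict m = 1 ∸ (k + k + m * m ∸ total M n m)

  -- The degrees overwrite the matrix from its front. Cells below `row` are final, cells from n *
  -- `row` on are still input, and nothing is claimed about those in between.
  record Degrees (j : ℕ) (s : State) : Set where
    field
      left    : reg s todo ≡ j
      current : reg s row + j ≡ n
      sizeₙ   : reg s size ≡ n
      boundₖ  : reg s bound ≡ k
      one₁    : reg s one ≡ 1
      threshold₀ : reg s threshold ≡ 0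
      count₀  : reg s count ≡ 0
      place   : reg s pointer ≡ n * reg s row
      done    : ∀ {a} → a < reg s row → mem s a ≡ degreeAt M n a
      intact  : ∀ {a} → n * reg s row ≤ a → mem s a ≡ M a

  -- Cell u lies in row 0, and rows 0 to u have been read when it is overwritten.
  degrees-step : ∀ {j s} → Degrees (suc j) s →
    ∃[ s′ ] ⟨ degreesStep , s ⟩⇓[ 3 + scanTime 1 n ] s′ × Degrees j s′
  degrees-step {j} {s} I with scan-runs {g = degreeTerm} degreeBody-evaluates s (Degrees.one₁ I)
  ... | s₁ , run , kept , pointer≡ , acc≡ =
    _ , retime time≡ (seq run (seq instr (seq instr instr)))
      , record
        { left       = cong₂ _∸_ (≡.trans (cong #todo kept) left) one≡1
        ; current    = ≡.trans (cong (_+ j) row≡) (≡.trans (≡.sym (+-suc _ j)) current)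
        ; sizeₙ      = ≡.trans (cong #size kept) sizeₙ
        ; boundₖ     = ≡.trans (cong #bound kept) boundₖ
        ; one₁       = one≡1
        ; threshold₀ = ≡.trans (cong #threshold kept) threshold₀
        ; count₀     = ≡.trans (cong #count kept) count₀
        ; place      = begin
            reg s₁ pointer                ≡⟨ pointer≡ ⟩
            reg s pointer + reg s size    ≡⟨ cong₂ _+_ place sizeₙ ⟩
            n * reg s row + n             ≡⟨ +-comm _ n ⟩
            n + n * reg s row             ≡⟨ *-suc n _ ⟨
            n * suc (reg s row)           ≡⟨ cong (n *_) row≡ ⟨
            n * (reg s₁ row + reg s₁ one) ∎
        ; done       = λ {a} a< → done′ (subst (a <_) row≡ a<)
        ; intact     = λ {a} ≤a → intact′ (subst (λ r → n * r ≤ a) row≡ ≤a)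
        }
    where
    open Degrees I
    open ≡-Reasoning
    time≡ : scanTime 1 (reg s size) + 3 ≡ 3 + scanTime 1 n
    time≡ = ≡.trans (+-comm (scanTime 1 (reg s size)) 3) (cong (λ x → 3 + scanTime 1 x) sizeₙ)
    one≡1 : reg s₁ one ≡ 1
    one≡1 = ≡.trans (cong #one kept) one₁
    row₁≡ : reg s₁ row ≡ reg s row
    row₁≡ = cong #row kept
    row≡ : reg s₁ row + reg s₁ one ≡ suc (reg s row)
    row≡ = ≡.trans (cong₂ _+_ row₁≡ one≡1) (+-comm _ 1)
    degree≡ : reg s₁ acc ≡ degreeAt M n (reg s row)
    degree≡ = begin
      reg s₁ acc ≡⟨ acc≡ ⟩
      sum {reg s size} (λ i → mem s (reg s pointer + toℕ i) ∸ reg s one)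
        ≡⟨ cong (λ z → sum {z} (λ i → mem s (reg s pointer + toℕ i) ∸ reg s one)) sizeₙ ⟩
      sum {n} (λ i → mem s (reg s pointer + toℕ i) ∸ reg s one)
        ≡⟨ sum-cong-≗ {n} (λ i → cong₂ _∸_
             (≡.trans (cong (λ p → mem s (p + toℕ i)) place) (intact (m≤m+n _ (toℕ i)))) one₁) ⟩
      degreeAt M n (reg s row) ∎
    mem₁≡ : mem s₁ ≡ mem s
    mem₁≡ = cong memory kept
    written : ∀ {a} → a ≢ reg s row → (mem s₁ [ reg s₁ row ↦ reg s₁ acc ]) a ≡ mem s a
    written {a} a≢ = ≡.trans
      (update-elsewhere (mem s₁) _ (λ a≡ → a≢ (≡.trans a≡ row₁≡))) (cong (λ m → m a) mem₁≡)
    done′ : ∀ {a} → a < suc (reg s row) →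
      (mem s₁ [ reg s₁ row ↦ reg s₁ acc ]) a ≡ degreeAt M n a
    done′ {a} (s≤s a≤row) with m≤n⇒m<n∨m≡n a≤row
    ... | inj₁ a<row = ≡.trans (written (<⇒≢ a<row)) (done a<row)
    ... | inj₂ a≡row = begin
      (mem s₁ [ reg s₁ row ↦ reg s₁ acc ]) a ≡⟨ cong (λ b → (mem s₁ [ b ↦ reg s₁ acc ]) a)
                                                   (≡.trans row₁≡ (≡.sym a≡row)) ⟩
      (mem s₁ [ a ↦ reg s₁ acc ]) a          ≡⟨ update-here (mem s₁) a _ ⟩
      reg s₁ acc                             ≡⟨ degree≡ ⟩
      degreeAt M n (reg s row)                   ≡⟨ cong (degreeAt M n) a≡row ⟨
      degreeAt M n a                             ∎
    -- A row still to be read forces n to be nonzero; for n = 0 the unread part would start at cell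
    -- 0 and contain the overwritten cell.
    row<n : reg s row < n
    row<n = subst (reg s row <_) current (m<m+n _ z<s)
    row<next : reg s row < n * suc (reg s row)
    row<next = m≤n*m _ n {{>-nonZero (≤-<-trans z≤n row<n)}}
    intact′ : ∀ {a} → n * suc (reg s row) ≤ a →
      (mem s₁ [ reg s₁ row ↦ reg s₁ acc ]) a ≡ M a
    intact′ next≤a = ≡.trans (written (≢-sym (<⇒≢ (<-≤-trans row<next next≤a))))
      (intact (≤-trans (*-monoʳ-≤ n (n≤1+n _)) next≤a))

  record Thresholds (j : ℕ) (s : State) : Set where
    field
      left    : reg s todo ≡ j
      sizeₙ   : reg s size ≡ n
      one₁    : reg s one ≡ 1
      bound≡  : reg s bound ≡ k + k + reg s threshold * reg s threshold
      stored  : ∀ {a} → a < n → mem s a ≡ degreeAt M n a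
      so-far  : reg s count + sum {j} (λ i → verdict (reg s threshold + toℕ i))
              ≡ sum {suc n} (λ i → verdict (toℕ i))

  thresholds-step : ∀ {j s} → Thresholds (suc j) s →
    ∃[ s′ ] ⟨ thresholdsStep , s ⟩⇓[ 8 + scanTime 4 n ] s′ × Thresholds j s′
  thresholds-step {j} {s} I
    with scan-runs {g = thresholdTerm} thresholdBody-evaluates (⟦ const pointer 0 ⟧ s)
           (Thresholds.one₁ I)
  ... | s₁ , run , kept , pointer≡ , acc≡ =
    _ , retime time≡
          (seq instr (seq run (seq instr (seq instr (seq instr (seq instr
            (seq instr (seq instr instr))))))))
      , record
        { left   = cong₂ _∸_ (≡.trans (cong #todo kept) left) one≡1
        ; sizeₙ  = ≡.trans (cong #size kept) sizeₙ
        ; one₁   = one≡1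
        ; bound≡ = bound′
        ; stored = λ {a} a<n → ≡.trans (cong (λ κ → memory κ a) kept) (stored a<n)
        ; so-far = so-far′
        }
    where
    open Thresholds I
    open ≡-Reasoning
    m : ℕ
    m = reg s threshold
    time≡ : 1 + (scanTime 4 (reg s size) + 7) ≡ 8 + scanTime 4 n
    time≡ = cong suc (≡.trans (+-comm (scanTime 4 (reg s size)) 7)
                              (cong (λ x → 7 + scanTime 4 x) sizeₙ))
    one≡1 : reg s₁ one ≡ 1
    one≡1 = ≡.trans (cong #one kept) one₁
    threshold≡ : reg s₁ threshold ≡ m
    threshold≡ = cong #threshold kept
    next : reg s₁ threshold + reg s₁ one ≡ suc m
    next = ≡.trans (cong₂ _+_ threshold≡ one≡1) (+-comm _ 1)
    bound₁ : reg s₁ bound ≡ k + k + m * m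
    bound₁ = ≡.trans (cong #bound kept) bound≡
    square : ∀ b m → b + m * m + m + suc m ≡ b + suc m * suc m
    square = solve-∀
    bound′ : reg s₁ bound + reg s₁ threshold + (reg s₁ threshold + reg s₁ one)
           ≡ k + k + (reg s₁ threshold + reg s₁ one) * (reg s₁ threshold + reg s₁ one)
    bound′ = begin
      reg s₁ bound + reg s₁ threshold + (reg s₁ threshold + reg s₁ one)
        ≡⟨ cong₂ _+_ (cong₂ _+_ bound₁ threshold≡) next ⟩
      k + k + m * m + m + suc m ≡⟨ square (k + k) m ⟩
      k + k + suc m * suc m     ≡⟨ cong (λ x → k + k + x * x) next ⟨
      k + k + (reg s₁ threshold + reg s₁ one) * (reg s₁ threshold + reg s₁ one) ∎
    total≡ : reg s₁ acc ≡ total M n m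
    total≡ = begin
      reg s₁ acc ≡⟨ acc≡ ⟩
      -- Resetting `pointer` leaves the frame untouched and makes the scan start at cell 0, where
      -- the degrees are now stored.
      sum {reg s size} (λ i → thresholdTerm (frame s) (mem s (toℕ i)))
        ≡⟨ cong (λ z → sum {z} (λ i → thresholdTerm (frame s) (mem s (toℕ i)))) sizeₙ ⟩
      sum {n} (λ i → thresholdTerm (frame s) (mem s (toℕ i)))
        ≡⟨ sum-cong-≗ {n} (λ i → cong₂ (λ o d → d + (m ∸ d) + (m ∸ d ∸ o))
             one₁ (stored (Fin.toℕ<n i))) ⟩
      total M n m ∎
    verdict≡ : reg s₁ one ∸ (reg s₁ bound ∸ reg s₁ acc) ≡ verdict (m + 0)
    verdict≡ = ≡.trans (cong₂ _∸_ one≡1 (cong₂ _∸_ bound₁ total≡))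
                       (cong verdict (≡.sym (+-identityʳ m)))
    so-far′ : reg s₁ count + (reg s₁ one ∸ (reg s₁ bound ∸ reg s₁ acc))
                + sum {j} (λ i → verdict (reg s₁ threshold + reg s₁ one + toℕ i))
            ≡ sum {suc n} (λ i → verdict (toℕ i))
    so-far′ = ≡.trans
      (cong₂ _+_ (cong₂ _+_ (cong #count kept) verdict≡)
        (sum-cong-≗ {j} λ i →
          cong verdict (≡.trans (cong (_+ toℕ i) next) (≡.sym (+-suc m (toℕ i))))))
      (≡.trans (+-assoc (reg s count) _ _) so-far)

  thresholds-start : ∀ {s} → Degrees 0 s →
    Thresholds (suc n) (⟦ add todo size one ⟧ (⟦ add bound bound bound ⟧ s))
  thresholds-start {s} I = record
    { left   = ≡.trans (cong₂ _+_ sizeₙ one₁) (+-comm n 1)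
    ; sizeₙ  = sizeₙ
    ; one₁   = one₁
    ; bound≡ = bound≡
    ; stored = λ {a} a<n → done (subst (a <_) (≡.trans (≡.sym current) (+-identityʳ _)) a<n)
    ; so-far = so-far
    }
    where
    open Degrees I
    open ≡-Reasoning
    bound≡ : reg s bound + reg s bound ≡ k + k + reg s threshold * reg s threshold
    bound≡ = begin
      reg s bound + reg s bound                   ≡⟨ cong₂ _+_ boundₖ boundₖ ⟩
      k + k                                       ≡⟨ +-identityʳ (k + k) ⟨
      k + k + 0 * 0                               ≡⟨ cong (λ m → k + k + m * m) threshold₀ ⟨
      k + k + reg s threshold * reg s threshold   ∎
    so-far : reg s count + sum {suc n} (λ i → verdict (reg s threshold + toℕ i))
           ≡ sum {suc n} (λ i → verdict (toℕ i))
    so-far = cong₂ (λ c m → c + sum {suc n} (λ i → verdict (m + toℕ i))) count₀ threshold₀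

  thresholds-run : ∀ {s} → Degrees 0 s →
    ∃[ s′ ] ⟨ thresholds , s ⟩⇓[ thresholdsTime n ] s′ × Thresholds 0 s′
  thresholds-run I =
    let s , run , J = while-rule Thresholds Thresholds.left thresholds-step (suc n)
                        (thresholds-start I)
    in  s , seq instr (seq instr run) , J

  degrees-start : ∀ {ρ} → ρ size ≡ n → ρ bound ≡ k → (∀ {r} → 1 < r → ρ r ≡ 0) →
    Degrees n (⟦ move todo size ⟧ (⟦ const one 1 ⟧ ⟪ ρ , M ⟫))
  degrees-start {ρ} size≡ bound≡ zeros = record
    { left       = size≡
    ; current    = cong (_+ n) row₀
    ; sizeₙ      = size≡
    ; boundₖ     = bound≡
    ; one₁       = refl
    ; threshold₀ = zeros (s<s z<s)
    ; count₀     = zeros (s<s z<s)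
    ; place      = ≡.trans (zeros (s<s z<s))
        (≡.trans (≡.sym (*-zeroʳ n)) (cong (n *_) (≡.sym row₀)))
    ; done       = λ {a} a<row → contradiction (subst (a <_) row₀ a<row) n≮0
    ; intact     = λ _ → refl
    }
    where
    row₀ : ρ row ≡ 0
    row₀ = zeros (s<s z<s)

  clustering-runs : ∀ {ρ} → ρ size ≡ n → ρ bound ≡ k → (∀ {r} → 1 < r → ρ r ≡ 0) →
    ∃[ s ] ⟨ clustering , ⟪ ρ , M ⟫ ⟩⇓[ clusteringTime n ] s
      × reg s 0 ≡ 1 ∸ (1 ∸ sum {suc n} (λ m → verdict (toℕ m)))
  clustering-runs size≡ bound≡ zeros =
    let s₁ , run₁ , I₁ = while-rule Degrees Degrees.left degrees-step n
                           (degrees-start size≡ bound≡ zeros)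
        s₂ , run₂ , I₂ = thresholds-run I₁
        open Thresholds I₂
    in  _ , seq instr (seq (seq instr run₁) (seq run₂ (seq instr instr)))
          , cong₂ _∸_ one₁ (cong₂ _∸_ one₁ (≡.trans (≡.sym (+-identityʳ _)) so-far))

-- Counting stable edges

bit : Bool → ℕ
bit b = if b then 1 else 0

sum-mono-≤ : ∀ {n} {f g : Fin n → ℕ} → (∀ i → f i ≤ g i) → sum f ≤ sum g
sum-mono-≤ {zero}  f≤g = z≤n
sum-mono-≤ {suc n} f≤g = +-mono-≤ (f≤g zero) (sum-mono-≤ (f≤g ∘ suc))

sum-≥-term : ∀ {n} (f : Fin n → ℕ) i → f i ≤ sum f
sum-≥-term f zero    = m≤m+n _ _
sum-≥-term f (suc i) = m≤n⇒m≤o+n _ (sum-≥-term (f ∘ suc) i)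

sum-zero : ∀ {n} {f : Fin n → ℕ} → (∀ i → f i ≡ 0) → sum f ≡ 0
sum-zero {n} f≡0 = ≡.trans (sum-cong-≗ f≡0) (sum-replicate-zero n)

∑∑-cong : ∀ {m n} {f g : Fin m → Fin n → ℕ} → (∀ u v → f u v ≡ g u v) →
  sum (λ u → sum (f u)) ≡ sum (λ u → sum (g u))
∑∑-cong f≡g = sum-cong-≗ λ u → sum-cong-≗ (f≡g u)

∑∑-distrib-+ : ∀ {m n} (f g : Fin m → Fin n → ℕ) →
  sum (λ u → sum (λ v → f u v + g u v)) ≡ sum (λ u → sum (f u)) + sum (λ u → sum (g u))
∑∑-distrib-+ f g = ≡.trans (sum-cong-≗ λ u → ∑-distrib-+ (f u) (g u))
                           (∑-distrib-+ (λ u → sum (f u)) (λ u → sum (g u)))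

∑∑-product : ∀ {m n} (f : Fin m → ℕ) (g : Fin n → ℕ) →
  sum (λ u → sum (λ v → f u * g v)) ≡ sum f * sum g
∑∑-product f g = ≡.trans (sum-cong-≗ λ u → ≡.sym (*-distribˡ-sum (f u) g))
                         (≡.sym (*-distribʳ-sum (sum g) f))

sum-indicator : ∀ {n} (u : Fin n) → sum (λ v → bit (does (u Fin.≟ v))) ≡ 1
sum-indicator {suc n} zero    = cong suc (sum-zero {n} λ _ → refl)
sum-indicator {suc n} (suc u) = sum-indicator u

listSum-tabulate : ∀ {n} (f : Fin n → ℕ) → listSum (tabulate f) ≡ sum f
listSum-tabulate {zero}  f = refl
listSum-tabulate {suc n} f = cong (f zero +_) (listSum-tabulate (f ∘ suc))

listSum-allFin : ∀ {n} (f : Fin n → ℕ) → listSum (List.map f (allFin n)) ≡ sum f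
listSum-allFin f = ≡.trans (cong listSum (List.map-tabulate (λ i → i) f)) (listSum-tabulate f)

module _ {a} {A : Set a} where

  length-filter : ∀ {p} {P : A → Set p} (P? : Decidable P) xs →
    length (filter P? xs) ≡ listSum (List.map (bit ∘ does ∘ P?) xs)
  length-filter P? []       = refl
  length-filter P? (x ∷ xs) with does (P? x)
  ... | true  = cong suc (length-filter P? xs)
  ... | false = length-filter P? xs

  listSum-filter : ∀ {p} {P : A → Set p} (P? : Decidable P) (f : A → ℕ) xs →
    listSum (List.map f (filter P? xs)) ≡ listSum (List.map (λ x → bit (does (P? x)) * f x) xs)
  listSum-filter P? f []       = refl
  listSum-filter P? f (x ∷ xs) with does (P? x)
  ... | true  = cong₂ _+_ (≡.sym (*-identityˡ (f x))) (listSum-filter P? f xs)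
  ... | false = listSum-filter P? f xs

  listSum-cartesianProduct : ∀ {b} {B : Set b} (f : A × B → ℕ) xs ys →
    listSum (List.map f (cartesianProduct xs ys))
      ≡ listSum (List.map (λ x → listSum (List.map (λ y → f (x , y)) ys)) xs)
  listSum-cartesianProduct f []       ys = refl
  listSum-cartesianProduct f (x ∷ xs) ys = begin
    listSum (List.map f (List.map (x ,_) ys ++ cartesianProduct xs ys))
      ≡⟨ cong listSum (List.map-++ f (List.map (x ,_) ys) _) ⟩
    listSum (List.map f (List.map (x ,_) ys) ++ List.map f (cartesianProduct xs ys))
      ≡⟨ sum-++ (List.map f (List.map (x ,_) ys)) _ ⟩
    listSum (List.map f (List.map (x ,_) ys)) + listSum (List.map f (cartesianProduct xs ys))
      ≡⟨ cong₂ _+_ (cong listSum (≡.sym (List.map-∘ ys))) (listSum-cartesianProduct f xs ys) ⟩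
    _ ∎
    where open ≡-Reasoning

double : ∀ x → x + x ≡ 2 * x
double = solve-∀

module _ {q n : ℕ} (G : EdgeColouredGraph q n) (f : VertexColouring q n) where

  stableBit : Fin n → Fin n → ℕ
  stableBit u v = bit (does (stable? G f (u , v)))

  below : Fin n → Fin n → ℕ
  below u v = bit (does (u Fin.<? v))

  -- Each filter becomes a 0/1 factor, which moves the count from lists to double sums, where
  -- summations can be split and exchanged.
  #stable-∑ : #stable G f ≡ sum (λ u → sum (λ v → below u v * stableBit u v))
  #stable-∑ = begin
    #stable G f
      ≡⟨ length-filter (stable? G f) (vertexPairs n) ⟩
    listSum (List.map (bit ∘ does ∘ stable? G f) (vertexPairs n))
      ≡⟨ listSum-filter _ _ (cartesianProduct (allFin n) (allFin n)) ⟩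
    listSum (List.map (λ (u , v) → below u v * stableBit u v)
                      (cartesianProduct (allFin n) (allFin n)))
      ≡⟨ listSum-cartesianProduct _ (allFin n) (allFin n) ⟩
    listSum (List.map (λ u → listSum (List.map (λ v → below u v * stableBit u v) (allFin n)))
                      (allFin n))
      ≡⟨ listSum-allFin (λ u → listSum (List.map (λ v → below u v * stableBit u v) (allFin n))) ⟩
    sum (λ u → listSum (List.map (λ v → below u v * stableBit u v) (allFin n)))
      ≡⟨ sum-cong-≗ (λ u → listSum-allFin (λ v → below u v * stableBit u v)) ⟩
    sum (λ u → sum (λ v → below u v * stableBit u v)) ∎
    where open ≡-Reasoning

  -- `Stable` compares the edge with the colour of its first vertex only; the equation `f u ≡ f v`
  -- transfers this to the second.
  stableBit-sym : ∀ u v → stableBit u v ≡ stableBit v u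
  stableBit-sym u v =
    cong bit (does-⇔ (mk⇔ (swap u v) (swap v u)) (stable? G f (u , v)) (stable? G f (v , u)))
    where
    swap : ∀ u v → Stable G f (u , v) → Stable G f (v , u)
    swap u v (ψ≡ , fu≡fv) =
      ≡.trans (EdgeColouredGraph.sym G v u) (≡.trans ψ≡ (cong just fu≡fv)) , ≡.sym fu≡fv

  stableBit-loop : ∀ v → stableBit v v ≡ 0
  stableBit-loop v = cong bit (dec-false (stable? G f (v , v)) λ where
    (ψ≡ , _) → case (≡.trans (≡.sym (noLoop G v)) ψ≡))
    where
    case : ∀ {c : Fin q} → nothing ≢ just c
    case ()

  -- Off the diagonal, trichotomy keeps one of the two order factors; on the diagonal everything
  -- vanishes, as there are no loops.
  stableBit-split : ∀ u v →
    stableBit u v ≡ below u v * stableBit u v + below v u * stableBit v u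
  stableBit-split u v with Fin.<-cmp u v
  ... | tri< u<v _ v≮u rewrite dec-true (u Fin.<? v) u<v | dec-false (v Fin.<? u) v≮u =
    ≡.sym (≡.trans (+-identityʳ _) (*-identityˡ _))
  ... | tri> u≮v _ v<u rewrite dec-false (u Fin.<? v) u≮v | dec-true (v Fin.<? u) v<u =
    ≡.trans (stableBit-sym u v) (≡.sym (*-identityˡ _))
  ... | tri≈ _ refl _ rewrite stableBit-loop u | *-zeroʳ (below u u) = refl

  -- The split yields the sum over u < v twice, the second time with its summations exchanged.
  ∑∑-stable : sum (λ u → sum (stableBit u)) ≡ 2 * #stable G f
  ∑∑-stable = begin
    sum (λ u → sum (stableBit u))
      ≡⟨ ∑∑-cong stableBit-split ⟩
    sum (λ u → sum (λ v → ordered u v + ordered v u))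
      ≡⟨ ∑∑-distrib-+ ordered (λ u v → ordered v u) ⟩
    sum (λ u → sum (ordered u)) + sum (λ u → sum (λ v → ordered v u))
      ≡⟨ cong (sum (λ u → sum (ordered u)) +_) (∑-comm (λ u v → ordered v u)) ⟩
    sum (λ u → sum (ordered u)) + sum (λ u → sum (ordered u))
      ≡⟨ cong₂ _+_ #stable-∑ #stable-∑ ⟨
    #stable G f + #stable G f
      ≡⟨ double (#stable G f) ⟩
    2 * #stable G f ∎
    where
    open ≡-Reasoning
    ordered : Fin n → Fin n → ℕ
    ordered u v = below u v * stableBit u v

-- The address is `toℕ (combine u v)`, so the range test succeeds and `remQuot` recovers the pair.
matrix-at : ∀ {q n} (G : EdgeColouredGraph q n) u v →
  matrix G (n * toℕ u + toℕ v) ≡ code (ψ G u v)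
matrix-at {n = n} G u v rewrite ≡.sym (Fin.toℕ-combine u v) with toℕ (combine u v) <? n * n
... | yes lt = cong (λ (x , y) → code (ψ G x y))
  (≡.trans (cong (remQuot n) (Fin.fromℕ<-toℕ (combine u v) lt)) (Fin.remQuot-combine u v))
... | no ≮  = contradiction (Fin.toℕ<n (combine u v)) ≮

-- Two colours: the identity for a single edge and bounds on the gain.

in₁ in₂ : Fin 2 → ℕ
in₁ zero    = 1
in₁ (suc _) = 0
in₂ zero    = 0
in₂ (suc _) = 1

-- Let x and y be the indicators of colour 1 at the two ends. An edge of colour 1 is stable when xy
-- = 1; one of colour 2 contributes (1 - x)(1 - y) = (1 - y) - x + xy. The negative term is moved to
-- the left. The `+ 0` is the diagonal indicator of `pair-balance` at distinct vertices.
edge-balance : (c : Maybe (Fin 2)) (i j : Fin 2) → Is-just c →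
  bit (does (Maybe.≡-dec Fin._≟_ c (just i) ×-dec (i Fin.≟ j))) + in₁ i * ((code c ∸ 1) + 0)
    ≡ in₂ j * (code c ∸ 1) + in₁ i * in₁ j
edge-balance (just zero)       zero       zero       _ = refl
edge-balance (just zero)       zero       (suc zero) _ = refl
edge-balance (just zero)       (suc zero) zero       _ = refl
edge-balance (just zero)       (suc zero) (suc zero) _ = refl
edge-balance (just (suc zero)) zero       zero       _ = refl
edge-balance (just (suc zero)) zero       (suc zero) _ = refl
edge-balance (just (suc zero)) (suc zero) zero       _ = refl
edge-balance (just (suc zero)) (suc zero) (suc zero) _ = refl

-- With the next three lemmas this characterises `gain m d` as max(d, 2m - d - 1), the subtracted d
-- + 1 being moved across. Here one copy of m is covered by d + (m ∸ d), the other by (d + 1) + (m ∸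
-- (d + 1)).
gain-≥-first : ∀ m d → 2 * m ≤ gain m d + suc d
gain-≥-first m d = begin
  2 * m                                     ≡⟨ double m ⟨
  m + m                                     ≤⟨ +-mono-≤ (m≤n+m∸n m d) (m≤n+m∸n m (suc d)) ⟩
  d + (m ∸ d) + (suc d + (m ∸ suc d))       ≡⟨ cong (λ x → d + (m ∸ d) + (suc d + x)) shift ⟩
  d + (m ∸ d) + (suc d + (m ∸ d ∸ 1))       ≡⟨ regroup (d + (m ∸ d)) (suc d) _ ⟩
  gain m d + suc d                          ∎
  where
  open ≤-Reasoning
  shift : m ∸ suc d ≡ m ∸ d ∸ 1
  shift = ≡.trans (cong (m ∸_) (+-comm 1 d)) (≡.sym (∸-+-assoc m d 1))
  regroup : ∀ a b c → a + (b + c) ≡ a + c + b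
  regroup = solve-∀

gain-≥-second : ∀ m d → d ≤ gain m d
gain-≥-second m d = ≤-trans (m≤m+n d _) (m≤m+n _ _)

gain-first : ∀ {m d} → d < m → gain m d + suc d ≡ 2 * m
gain-first {m} {d} d<m with m≤n⇒∃[o]m+o≡n d<m
... | e , refl = ≡.trans (cong (λ x → d + x + (x ∸ 1) + suc d) difference) (collect d e)
  where
  difference : suc d + e ∸ d ≡ suc e
  difference = ≡.trans (cong (_∸ d) (≡.sym (+-suc d e))) (m+n∸m≡n d (suc e))
  collect : ∀ d e → d + suc e + e + suc d ≡ 2 * (suc d + e)
  collect = solve-∀

gain-second : ∀ {m d} → m ≤ d → gain m d ≡ d
gain-second {m} {d} m≤d rewrite m≤n⇒m∸n≡0 m≤d = ≡.trans (+-identityʳ _) (+-identityʳ _)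

-- The two sides differ by e², where e is the distance between `m` and `n`.
2mn≤m²+n² : ∀ m n → 2 * (m * n) ≤ m * m + n * n
2mn≤m²+n² m n with ≤-total m n
... | inj₁ m≤n with m≤n⇒∃[o]m+o≡n m≤n
...   | e , refl = ≤-trans (m≤m+n _ (e * e)) (≤-reflexive (lemma m e))
  where
  lemma : ∀ m e → 2 * (m * (m + e)) + e * e ≡ m * m + (m + e) * (m + e)
  lemma = solve-∀
2mn≤m²+n² m n | inj₂ n≤m with m≤n⇒∃[o]m+o≡n n≤m
...   | e , refl = ≤-trans (m≤m+n _ (e * e)) (≤-reflexive (lemma n e))
  where
  lemma : ∀ n e → 2 * ((n + e) * n) + e * e ≡ (n + e) * (n + e) + n * n
  lemma = solve-∀

-- The optimum over all vertex colourings.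

module _ {n : ℕ} (G : EdgeColouredGraph 2 n) (complete : Complete G) where

  isSecond : Fin n → Fin n → ℕ
  isSecond u v = code (ψ G u v) ∸ 1

  degree₂ : Fin n → ℕ
  degree₂ u = sum (isSecond u)

  isSecond-sym : ∀ u v → isSecond u v ≡ isSecond v u
  isSecond-sym u v = cong (λ c → code c ∸ 1) (EdgeColouredGraph.sym G u v)

  module _ (f : VertexColouring 2 n) where

    #first : ℕ
    #first = sum (in₁ ∘ f)

    -- The pairs (u , u) occur in s² without being edges. The indicator of u = v compensates for
    -- them, and is the source of the 1 in d(v) + 1.
    pair-balance : ∀ u v →
      stableBit G f u v + in₁ (f u) * (isSecond u v + bit (does (u Fin.≟ v)))
        ≡ in₂ (f v) * isSecond u v + in₁ (f u) * in₁ (f v)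
    pair-balance u v with u Fin.≟ v
    ... | no u≢v   = edge-balance (ψ G u v) (f u) (f v) (complete u v u≢v)
    ... | yes refl rewrite stableBit-loop G f u | noLoop G u with f u
    ...   | zero     = refl
    ...   | suc zero = refl

    -- This is `pair-balance` summed over all ordered pairs.
    balance :
      2 * #stable G f + sum (λ u → in₁ (f u) * suc (degree₂ u))
        ≡ sum (λ v → in₂ (f v) * degree₂ v) + #first * #first
    balance = begin
      2 * #stable G f + sum (λ u → in₁ (f u) * suc (degree₂ u))
        ≡⟨ cong₂ _+_ (≡.sym (∑∑-stable G f)) (sum-cong-≗ λ u → ≡.sym (row-sum u)) ⟩
      sum (λ u → sum (stableBit G f u)) + sum (λ u → sum (λ v → charge u v))
        ≡⟨ ∑∑-distrib-+ (stableBit G f) charge ⟨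
      sum (λ u → sum (λ v → stableBit G f u v + charge u v))
        ≡⟨ ∑∑-cong pair-balance ⟩
      sum (λ u → sum (λ v → in₂ (f v) * isSecond u v + in₁ (f u) * in₁ (f v)))
        ≡⟨ ∑∑-distrib-+ (λ u v → in₂ (f v) * isSecond u v) (λ u v → in₁ (f u) * in₁ (f v)) ⟩
      sum (λ u → sum (λ v → in₂ (f v) * isSecond u v))
        + sum (λ u → sum (λ v → in₁ (f u) * in₁ (f v)))
        -- The factor `in₂ (f v)` belongs to the second vertex, so this sum is taken by columns;
        -- symmetry of `isSecond` makes a column sum a degree.
        ≡⟨ cong₂ _+_ (∑-comm (λ u v → in₂ (f v) * isSecond u v))
                     (∑∑-product (in₁ ∘ f) (in₁ ∘ f)) ⟩
      sum (λ v → sum (λ u → in₂ (f v) * isSecond u v)) + #first * #first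
        ≡⟨ cong (_+ #first * #first) (sum-cong-≗ column-sum) ⟩
      sum (λ v → in₂ (f v) * degree₂ v) + #first * #first ∎
      where
      open ≡-Reasoning
      charge : Fin n → Fin n → ℕ
      charge u v = in₁ (f u) * (isSecond u v + bit (does (u Fin.≟ v)))
      row-sum : ∀ u → sum (charge u) ≡ in₁ (f u) * suc (degree₂ u)
      row-sum u = begin
        sum (charge u)
          ≡⟨ *-distribˡ-sum (in₁ (f u)) (λ v → isSecond u v + bit (does (u Fin.≟ v))) ⟨
        in₁ (f u) * sum (λ v → isSecond u v + bit (does (u Fin.≟ v)))
          ≡⟨ cong (in₁ (f u) *_) (∑-distrib-+ (isSecond u) _) ⟩
        in₁ (f u) * (degree₂ u + sum (λ v → bit (does (u Fin.≟ v))))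
          ≡⟨ cong (λ x → in₁ (f u) * (degree₂ u + x)) (sum-indicator u) ⟩
        in₁ (f u) * (degree₂ u + 1)
          ≡⟨ cong (in₁ (f u) *_) (+-comm _ 1) ⟩
        in₁ (f u) * suc (degree₂ u) ∎
      column-sum : ∀ v → sum (λ u → in₂ (f v) * isSecond u v) ≡ in₂ (f v) * degree₂ v
      column-sum v = begin
        sum (λ u → in₂ (f v) * isSecond u v) ≡⟨ *-distribˡ-sum (in₂ (f v)) (λ u → isSecond u v) ⟨
        in₂ (f v) * sum (λ u → isSecond u v) ≡⟨ cong (in₂ (f v) *_)
                                                  (sum-cong-≗ λ u → isSecond-sym u v) ⟩
        in₂ (f v) * degree₂ v                ∎

    -- Guarantees that m = |S| is among the values tried.
    #first≤n : #first ≤ n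
    #first≤n = ≤-trans (sum-mono-≤ {g = λ _ → 1} (bounded ∘ f)) (≤-reflexive (ones n))
      where
      bounded : ∀ i → in₁ i ≤ 1
      bounded zero    = ≤-refl
      bounded (suc _) = z≤n
      ones : ∀ m → sum {m} (λ _ → 1) ≡ m
      ones zero    = refl
      ones (suc m) = cong suc (ones m)

    weight charge₁ : ℕ
    weight  = sum (λ v → in₂ (f v) * degree₂ v)
    charge₁ = sum (λ v → in₁ (f v) * suc (degree₂ v))

    split-sum : ∀ m →
      sum (λ v → in₂ (f v) * degree₂ v + in₁ (f v) * (2 * m)) ≡ weight + #first * (2 * m)
    split-sum m = ≡.trans (∑-distrib-+ (λ v → in₂ (f v) * degree₂ v) _)
      (cong (weight +_) (≡.sym (*-distribʳ-sum (2 * m) (in₁ ∘ f))))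

  totalGain : ℕ → ℕ
  totalGain m = sum (λ v → gain m (degree₂ v))

  -- At m = s, `balance` turns the left side into a sum over vertices: d outside S and 2s - d - 1
  -- inside, each at most the gain. Adding `charge₁ f` to both sides avoids negative terms.
  stable≤totalGain : ∀ f → 2 * #stable G f + #first f * #first f ≤ totalGain (#first f)
  stable≤totalGain f = +-cancelʳ-≤ (charge₁ f) _ _ (begin
    2 * #stable G f + s * s + charge₁ f
      ≡⟨ swap (2 * #stable G f) (s * s) (charge₁ f) ⟩
    2 * #stable G f + charge₁ f + s * s
      ≡⟨ cong (_+ s * s) (balance f) ⟩
    weight f + s * s + s * s
      ≡⟨ twice (weight f) s ⟩
    weight f + s * (2 * s)
      ≡⟨ split-sum f s ⟨
    sum (λ v → in₂ (f v) * degree₂ v + in₁ (f v) * (2 * s))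
      ≤⟨ sum-mono-≤ (λ v → pointwise (f v) (degree₂ v)) ⟩
    sum (λ v → gain s (degree₂ v) + in₁ (f v) * suc (degree₂ v))
      ≡⟨ ∑-distrib-+ (λ v → gain s (degree₂ v)) _ ⟩
    totalGain s + charge₁ f ∎)
    where
    open ≤-Reasoning
    s : ℕ
    s = #first f
    swap : ∀ a b c → a + b + c ≡ a + c + b
    swap = solve-∀
    twice : ∀ a b → a + b * b + b * b ≡ a + b * (2 * b)
    twice = solve-∀
    pointwise : ∀ i d → in₂ i * d + in₁ i * (2 * s) ≤ gain s d + in₁ i * suc d
    pointwise zero       d = subst₂ _≤_ (≡.sym (*-identityˡ (2 * s)))
      (cong (gain s d +_) (≡.sym (*-identityˡ (suc d)))) (gain-≥-first s d)
    pointwise (suc zero) d = subst₂ _≤_ (≡.sym (≡.trans (+-identityʳ _) (*-identityˡ d)))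
      (≡.sym (+-identityʳ (gain s d))) (gain-≥-second s d)

  thresholdColouring : ℕ → VertexColouring 2 n
  thresholdColouring m v = if does (degree₂ v <? m) then zero else suc zero

  -- The threshold colouring attains the gain at every vertex. Its |S| may differ from m, and the
  -- only loss is in 2ms - m² ≤ s².
  totalGain≤stable : ∀ m → totalGain m ≤ 2 * #stable G (thresholdColouring m) + m * m
  totalGain≤stable m = +-cancelʳ-≤ (charge₁ f + s * s) _ _ (begin
    totalGain m + (charge₁ f + s * s)
      ≡⟨ +-assoc (totalGain m) _ _ ⟨
    totalGain m + charge₁ f + s * s
      ≡⟨ cong (_+ s * s) (∑-distrib-+ (λ v → gain m (degree₂ v)) _) ⟨
    sum (λ v → gain m (degree₂ v) + in₁ (f v) * suc (degree₂ v)) + s * s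
      ≡⟨ cong (_+ s * s) (sum-cong-≗ (λ v → pointwise (degree₂ v <? m))) ⟩
    sum (λ v → in₂ (f v) * degree₂ v + in₁ (f v) * (2 * m)) + s * s
      ≡⟨ cong (_+ s * s) (split-sum f m) ⟩
    weight f + s * (2 * m) + s * s
      ≡⟨ swap (weight f) s m ⟩
    weight f + s * s + 2 * (m * s)
      ≡⟨ cong (_+ 2 * (m * s)) (balance f) ⟨
    2 * #stable G f + charge₁ f + 2 * (m * s)
      ≤⟨ +-monoʳ-≤ (2 * #stable G f + charge₁ f) (2mn≤m²+n² m s) ⟩
    2 * #stable G f + charge₁ f + (m * m + s * s)
      ≡⟨ regroup (2 * #stable G f) (charge₁ f) (m * m) (s * s) ⟩
    2 * #stable G f + m * m + (charge₁ f + s * s) ∎)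
    where
    open ≤-Reasoning
    f : VertexColouring 2 n
    f = thresholdColouring m
    s : ℕ
    s = #first f
    swap : ∀ a s m → a + s * (2 * m) + s * s ≡ a + s * s + 2 * (m * s)
    swap = solve-∀
    regroup : ∀ a b c d → a + b + (c + d) ≡ a + c + (b + d)
    regroup = solve-∀
    -- Generalised to any decision of d < m, so that matching on it reduces the `if` in
    -- `thresholdColouring`.
    pointwise : ∀ {d} (d<m? : Dec (d < m)) → let i = if does d<m? then zero else suc zero in
      gain m d + in₁ i * suc d ≡ in₂ i * d + in₁ i * (2 * m)
    pointwise {d} (yes d<m) = ≡.trans (cong (gain m d +_) (*-identityˡ (suc d)))
      (≡.trans (gain-first d<m) (≡.sym (*-identityˡ (2 * m))))
    pointwise {d} (no d≮m)  = ≡.trans (+-identityʳ _)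
      (≡.trans (gain-second (≮⇒≥ d≮m)) (≡.sym (≡.trans (+-identityʳ _) (*-identityˡ d))))

  degreeAt-degree₂ : ∀ u → degreeAt (matrix G) n (toℕ u) ≡ degree₂ u
  degreeAt-degree₂ u = sum-cong-≗ λ v → cong (_∸ 1) (matrix-at G u v)

  total-totalGain : ∀ m → total (matrix G) n m ≡ totalGain m
  total-totalGain m = sum-cong-≗ λ v → cong (gain m) (degreeAt-degree₂ v)

  -- A passing m yields a threshold colouring with at least k stable edges; conversely a colouring
  -- with k stable edges makes m = |S| pass.
  correct : ∀ k {x} → x ≡ 1 ∸ (1 ∸ sum {suc n} (λ m → verdict (matrix G) n k (toℕ m))) →
    (ColouredClustering G k × x ≡ 1) ⊎ (¬ ColouredClustering G k × x ≡ 0)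
  correct k x≡
    with Fin.any? {n = suc n} (λ m → k + k + toℕ m * toℕ m ≤? total (matrix G) n (toℕ m))
  ... | yes (m , passes) =
    inj₁ ((thresholdColouring (toℕ m) , *-cancelˡ-≤ 2 (+-cancelʳ-≤ (toℕ m * toℕ m) _ _ bound′)) ,
          ≡.trans x≡ (cong (1 ∸_) (m≤n⇒m∸n≡0 positive)))
    where
    bound′ : 2 * k + toℕ m * toℕ m ≤ 2 * #stable G (thresholdColouring (toℕ m)) + toℕ m * toℕ m
    bound′ = begin
      2 * k + toℕ m * toℕ m         ≡⟨ cong (_+ toℕ m * toℕ m) (double k) ⟨
      k + k + toℕ m * toℕ m         ≤⟨ passes ⟩
      total (matrix G) n (toℕ m)  ≡⟨ total-totalGain (toℕ m) ⟩
      totalGain (toℕ m)             ≤⟨ totalGain≤stable (toℕ m) ⟩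
      2 * #stable G (thresholdColouring (toℕ m)) + toℕ m * toℕ m ∎
      where open ≤-Reasoning
    positive : 1 ≤ sum {suc n} (λ m → verdict (matrix G) n k (toℕ m))
    positive = ≤-trans (≤-reflexive (≡.sym (cong (1 ∸_) (m≤n⇒m∸n≡0 passes))))
                       (sum-≥-term (λ m → verdict (matrix G) n k (toℕ m)) m)
  ... | no none =
    inj₂ (no-colouring , ≡.trans x≡ (cong (λ t → 1 ∸ (1 ∸ t)) (sum-zero all-fail)))
    where
    all-fail : ∀ (m : Fin (suc n)) → verdict (matrix G) n k (toℕ m) ≡ 0
    -- A failed test leaves a positive difference, which truncates 1 to 0.
    all-fail m = m≤n⇒m∸n≡0 (m<n⇒0<n∸m (≰⇒> (λ passes → none (m , passes))))
    no-colouring : ¬ ColouredClustering G k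
    no-colouring (f , k≤) =
      none (fromℕ< (s≤s (#first≤n f)) ,
        subst (λ m → k + k + m * m ≤ total (matrix G) n m)
          (≡.sym (Fin.toℕ-fromℕ< (s≤s (#first≤n f))))
          (begin
            k + k + #first f * #first f             ≡⟨ cong (_+ #first f * #first f) (double k) ⟩
            2 * k + #first f * #first f             ≤⟨ +-monoˡ-≤ _ (*-monoʳ-≤ 2 k≤) ⟩
            2 * #stable G f + #first f * #first f   ≤⟨ stable≤totalGain f ⟩
            totalGain (#first f)                    ≡⟨ total-totalGain (#first f) ⟨
            total (matrix G) n (#first f)         ∎))
      where open ≤-Reasoning

-- The quadratic time bound and the conclusion.

clusteringTime-quadratic : clusteringTime ∈O (λ n → n ^ 2)
-- The time is 15n² + 28n + 20, and 63 is the sum of the coefficients, sufficient once n ≥ 1. At n =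
-- m + 1 the surplus 48n² - 28n - 20 equals 48m² + 68m.
clusteringTime-quadratic = 63 , 1 , bounded
  where
  slack : ∀ m → 1 + (2 + suc m * (4 + (3 + suc m * (5 + 1)))
                  + (3 + suc (suc m) * (9 + (3 + suc m * (5 + 4))) + 2))
                + (68 * m + 48 * (m * m)) ≡ 63 * (suc m * (suc m * 1))
  slack = solve-∀
  bounded : ∀ n → 1 ≤ n → clusteringTime n ≤ 63 * n ^ 2
  bounded (suc m) _ = ≤-trans (m≤m+n _ (68 * m + 48 * (m * m))) (≤-reflexive (slack m))

corollary4p5 : ∃[ p ] ∃[ T ] (T ∈O (λ n → n ^ 2)) ×
    (∀ n (G : EdgeColouredGraph 2 n) → Complete G →
    ∀ k → 1 ≤ k →
    p decides (ColouredClustering G k) on (input G k) within (T n))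
corollary4p5 = clustering , clusteringTime , clusteringTime-quadratic , λ n G complete k _ →
  let s , run , answer = clustering-runs (matrix G) n k refl refl (λ where (s≤s (s≤s _)) → refl)
  in  clusteringTime n , s , run , ≤-refl , correct G complete k answer
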